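{- (Zipper lemma) Let $n\ge 1$, let $G$ be a $2n$-acyclic Cayley graph with generator set $E$, let $v,u\in G$, and let $$v,\alpha_1,t_2,\alpha_2,t_3,\dots,t_\ell,\alpha_\ell,u\qquad\text{and}\qquad v,\beta_1,r_2,\beta_2,r_3,\dots,r_k,\beta_k,u$$ be two coset paths from $v$ to $u$ of lengths $\ell,k\leq n$. Put $t_1=r_1=v$, $t_{\ell+1}=r_{k+1}=u$ and $\alpha_0=\alpha_{\ell+1}=\beta_0=\beta_{k+1}=\emptyset$. Then 1. $[v]_{\beta_1\cap\alpha_1}\cap[t_2]_{\alpha_1\cap\alpha_2}\neq\emptyset$ or $[v]_{\alpha_1\cap\beta_1}\cap[r_2]_{\beta_1\cap\beta_2}\neq\emptyset$; and 2. $[u]_{\beta_k\cap\alpha_\ell}\cap[t_\ell]_{\alpha_\ell\cap\alpha_{\ell-1}}\neq\emptyset$ or $[u]_{\alpha_\ell\cap\beta_k}\cap[r_k]_{\beta_k\cap\beta_{k-1}}\neq\emptyset$.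
   Context: A Cayley group is a group $G$ (finite or infinite) with a generating set $E\subseteq G$ of non-trivial involutions ($e\neq 1$, $e^2=1$ for $e\in E$). Its Cayley graph, also denoted $G$, has vertex set $G$ and $e$-labelled edges $\{v,ve\}$ for $v\in G$, $e\in E$. For $\alpha\subseteq E$, $G_\alpha$ is the subgroup generated by $\alpha$, and $[v]_\alpha=vG_\alpha$ is the $\alpha$-coset of $v$. A coset cycle of length $m$ in $G$ is a sequence $((v_i,\alpha_i))_{i\in\mathbb{Z}_m}$ with $v_i\in G$, $\alpha_i\subseteq E$, such that for all $i\in\mathbb{Z}_m$: $v_i^{ -1}v_{i+1}\in G_{\alpha_i}$ and $[v_i]_{\alpha_{i-1}\cap\alpha_i}\cap[v_{i+1}]_{\alpha_i\cap\alpha_{i+1}}=\emptyset$. $G$ is $n$-acyclic if it has no coset cycle of length at most $n$. A coset path of length $\ell\geq1$ from $v_1$ to $v_{\ell+1}$ is a sequence $v_1,\alpha_1,v_2,\dots,\alpha_\ell,v_{\ell+1}$ with $v_i\in G$, $\alpha_i\subseteq E$, $v_i^{ -1}v_{i+1}\in G_{\alpha_i}$ for $1\le i\le\ell$, and $[v_i]_{\alpha_{i-1}\cap\alpha_i}\cap[v_{i+1}]_{\alpha_i\cap\alpha_{i+1}}=\emptyset$ for all $1\leq i\leq\ell$, where $\alpha_0=\alpha_{\ell+1}=\emptyset$. -}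

module Defs where

open import Algebra.Bundles using (Group)
open import Data.Fin.Base using (Fin; zero; suc; inject₁; fromℕ)
open import Data.Fin.Relation.Unary.Top using (view; ‵fromℕ; ‵inject₁)
open import Data.Nat.Base using (ℕ; zero; suc; _≤_)
open import Data.Product.Base using (∃; _×_)
open import Function.Base using (_∘_)
open import Level using (Level; _⊔_) renaming (suc to lsuc)
open import Relation.Binary.Definitions using (_Respects_)
open import Relation.Nullary.Negation.Core using (¬_)
open import Relation.Unary using (Pred; _∈_; _⊆_; _∩_; Empty)
open import Relation.Unary.Polymorphic using (∅)

-- Predecessor and successor on ℤ/(1+n).

predᶜ : ∀ {n} → Fin (suc n) → Fin (suc n)
predᶜ {n} zero    = fromℕ n
predᶜ     (suc i) = inject₁ i

sucᶜ : ∀ {n} → Fin (suc n) → Fin (suc n)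
sucᶜ i with view i
... | ‵fromℕ     = zero
... | ‵inject₁ j = suc j

-- For a finite sequence α₁, …, α_ℓ of sets, extended by α₀ = α_{ℓ+1} = ∅,
-- prev α i and next α i are the neighbours α_{i-1} and α_{i+1} of α_i.

module _ {a p : Level} {A : Set a} where

  prev : ∀ {l} → (Fin l → Pred A p) → Fin l → Pred A p
  prev α zero    = ∅
  prev α (suc i) = α (inject₁ i)

  next : ∀ {l} → (Fin l → Pred A p) → Fin l → Pred A p
  next {suc zero}    α zero    = ∅
  next {suc (suc _)} α zero    = α (suc zero)
  next {suc (suc _)} α (suc i) = next (α ∘ suc) i

module _ {c ℓ p : Level} (G : Group c ℓ) where
  open Group G

  data ⟨_⟩ (α : Pred Carrier p) : Pred Carrier (c ⊔ ℓ ⊔ p) where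
    gen  : ∀ {x} → x ∈ α → x ∈ ⟨ α ⟩
    unit : ε ∈ ⟨ α ⟩
    mul  : ∀ {x y} → x ∈ ⟨ α ⟩ → y ∈ ⟨ α ⟩ → x ∙ y ∈ ⟨ α ⟩
    inv  : ∀ {x} → x ∈ ⟨ α ⟩ → x ⁻¹ ∈ ⟨ α ⟩
    resp : ∀ {x y} → x ≈ y → x ∈ ⟨ α ⟩ → y ∈ ⟨ α ⟩

-- Subsets of the group are predicates that respect the setoid equality.

record CayleyGroup (c ℓ p : Level) : Set (lsuc (c ⊔ ℓ ⊔ p)) where
  field
    group : Group c ℓ

  open Group group public

  field
    E          : Pred Carrier p
    E-resp     : E Respects _≈_
    nontrivial : ∀ {e} → e ∈ E → ¬ (e ≈ ε)
    involutive : ∀ {e} → e ∈ E → e ∙ e ≈ ε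
    generates  : ∀ g → g ∈ ⟨_⟩ group E

  Subgroup : Pred Carrier p → Pred Carrier (c ⊔ ℓ ⊔ p)
  Subgroup α = ⟨_⟩ group α

  [_]_ : Carrier → Pred Carrier p → Pred Carrier (c ⊔ ℓ ⊔ p)
  ([ v ] α) x = ∃ λ g → g ∈ Subgroup α × x ≈ v ∙ g

  IsGeneratorSubset : Pred Carrier p → Set (c ⊔ ℓ ⊔ p)
  IsGeneratorSubset α = α ⊆ E × α Respects _≈_

  -- A coset cycle of length 1 + m.
  record CosetCycle (m : ℕ) : Set (lsuc (c ⊔ ℓ ⊔ p)) where
    field
      vertex   : Fin (suc m) → Carrier
      label    : Fin (suc m) → Pred Carrier p
      subset   : ∀ i → IsGeneratorSubset (label i)
      step     : ∀ i → vertex i ⁻¹ ∙ vertex (sucᶜ i) ∈ Subgroup (label i)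
      disjoint : ∀ i → Empty
        (  [ vertex i ]        (label (predᶜ i) ∩ label i)
         ∩ [ vertex (sucᶜ i) ] (label i ∩ label (sucᶜ i)))

  Acyclic : ℕ → Set (lsuc (c ⊔ ℓ ⊔ p))
  Acyclic n = ∀ m → suc m ≤ n → ¬ CosetCycle m

  -- A coset path of length 1 + l from v to u.  Indices are shifted down by
  -- one: i is the step from vertex (inject₁ i) to vertex (suc i).

  record CosetPath (l : ℕ) (v u : Carrier) : Set (lsuc (c ⊔ ℓ ⊔ p)) where
    field
      vertex   : Fin (suc (suc l)) → Carrier
      label    : Fin (suc l) → Pred Carrier p
      start    : vertex zero ≈ v
      end      : vertex (fromℕ (suc l)) ≈ u
      subset   : ∀ i → IsGeneratorSubset (label i)
      step     : ∀ i → vertex (inject₁ i) ⁻¹ ∙ vertex (suc i) ∈ Subgroup (label i)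
      disjoint : ∀ i → Empty
        (  [ vertex (inject₁ i) ] (prev label i ∩ label i)
         ∩ [ vertex (suc i) ]     (label i ∩ next label i))

{-# OPTIONS --safe #-}
-- Suppose that 1 fails.  Then u, βₖ, …, r₂, β₁, v, α₁, t₂, …, α_ℓ, u is a closed
-- coset path of length ℓ + k ≤ 2n: the corner conditions at v are exactly the
-- negation of 1.  No such path exists (no-closed-path): either it is already a
-- coset cycle, or the closing point can be moved so that the first or the last
-- step is absorbed by its neighbour, giving a shorter closed path.  Applying
-- this to the reversed paths gives 2.

module Submission where

open import Defs
open import Axiom.DoubleNegationElimination using (em⇒dne)
open import Axiom.ExcludedMiddle using (ExcludedMiddle)
open import Data.Empty using (⊥)
open import Data.Fin.Base using (Fin; zero; suc; inject₁; fromℕ; opposite)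
open import Data.Fin.Relation.Unary.Top using (view; ‵fromℕ; ‵inject₁)
open import Data.Nat.Base using (ℕ; zero; suc; _≤_; _+_; _*_)
open import Data.Nat.Properties using (+-suc; +-mono-≤; +-identityʳ; ≤-trans; n≤1+n)
open import Data.Product.Base using (_×_; _,_; proj₁; proj₂; swap)
open import Data.Sum.Base using (_⊎_; inj₁; inj₂)
open import Data.Vec.Functional using (_∷_)
open import Function.Base using (_∘_)
open import Level using (Level; _⊔_)
open import Relation.Binary.PropositionalEquality.Core using (_≡_; refl; sym; cong; subst)
open import Relation.Nullary using (yes; no)
open import Relation.Unary using (Pred; _∈_; _∉_; _⊆_; _∩_; Satisfiable; Empty)
open import Relation.Unary.Polymorphic using (∅)

-- Neighbours in a reversed sequence

opposite-inject₁ : ∀ {n} (i : Fin n) → opposite (inject₁ i) ≡ suc (opposite i)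
opposite-inject₁ zero    = refl
opposite-inject₁ (suc i) = cong inject₁ (opposite-inject₁ i)

opposite-fromℕ : ∀ n → opposite (fromℕ n) ≡ zero
opposite-fromℕ zero    = refl
opposite-fromℕ (suc n) = cong inject₁ (opposite-fromℕ n)

module _ {a p : Level} {A : Set a} where

  next-inject₁ : ∀ {l} (α : Fin (suc l) → Pred A p) (i : Fin l) →
                 next α (inject₁ i) ≡ α (suc i)
  next-inject₁ {suc _}       α zero    = refl
  next-inject₁ {suc (suc _)} α (suc i) = next-inject₁ (α ∘ suc) i

  next-fromℕ : ∀ l (α : Fin (suc l) → Pred A p) → next α (fromℕ l) ≡ ∅
  next-fromℕ zero    α = refl
  next-fromℕ (suc l) α = next-fromℕ l (α ∘ suc)

  -- For the induction in `next-opposite`: deleting the first entry of a reversed sequence deletes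
  -- the last entry of the original, which no index reaches through `prev`.
  prev-inject₁ : ∀ {l} (α : Fin (suc l) → Pred A p) (i : Fin l) →
                 prev (α ∘ inject₁) i ≡ prev α (inject₁ i)
  prev-inject₁ α zero    = refl
  prev-inject₁ α (suc i) = refl

  -- The boundary convention is symmetric: the first index of the reversal meets `∅` on its left, as
  -- the last index of `α` does on its right.
  prev-opposite : ∀ {l} (α : Fin l → Pred A p) (i : Fin l) →
                  prev (α ∘ opposite) i ≡ next α (opposite i)
  prev-opposite {suc l} α zero = sym (next-fromℕ l α)
  prev-opposite {suc l} α (suc i)
    rewrite opposite-inject₁ i | next-inject₁ α (opposite i) = refl

  next-opposite : ∀ {l} (α : Fin l → Pred A p) (i : Fin l) →
                  next (α ∘ opposite) i ≡ prev α (opposite i)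
  next-opposite {suc zero}    α zero    = refl
  next-opposite {suc (suc _)} α zero    = refl
  next-opposite {suc (suc _)} α (suc i)
    rewrite next-opposite (α ∘ inject₁) i = prev-inject₁ α (opposite i)

module _ {c ℓ p} (G : CayleyGroup c ℓ p) where
  open CayleyGroup G hiding (refl; sym)
  open CayleyGroup G using () renaming (refl to ≈-refl; sym to ≈-sym; trans to ≈-trans)
  open import Algebra.Properties.Group group using (⁻¹-anti-homo-\\)
  open import Relation.Binary.Reasoning.Setoid setoid hiding (start)

  -- Subgroups and cosets

  ⟨⟩-mono : ∀ {α β : Pred Carrier p} → α ⊆ β → Subgroup α ⊆ Subgroup β
  ⟨⟩-mono α⊆β (gen x∈α)  = gen (α⊆β x∈α)
  ⟨⟩-mono α⊆β unit       = unit
  ⟨⟩-mono α⊆β (mul g h)  = mul (⟨⟩-mono α⊆β g) (⟨⟩-mono α⊆β h)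
  ⟨⟩-mono α⊆β (inv g)    = inv (⟨⟩-mono α⊆β g)
  ⟨⟩-mono α⊆β (resp e g) = resp e (⟨⟩-mono α⊆β g)

  module _ {α : Pred Carrier p} where

    quotient⇒coset : ∀ {x y} → x ⁻¹ ∙ y ∈ Subgroup α → y ∈ [ x ] α
    quotient⇒coset {x} {y} q = x ⁻¹ ∙ y , q , (begin
      y               ≈⟨ identityˡ y ⟨
      ε ∙ y           ≈⟨ ∙-congʳ (inverseʳ x) ⟨
      x ∙ x ⁻¹ ∙ y    ≈⟨ assoc x (x ⁻¹) y ⟩
      x ∙ (x ⁻¹ ∙ y)  ∎)

    coset⇒quotient : ∀ {x y} → y ∈ [ x ] α → x ⁻¹ ∙ y ∈ Subgroup α
    coset⇒quotient {x} {y} (g , g∈ , y≈xg) = resp (begin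
      g               ≈⟨ identityˡ g ⟨
      ε ∙ g           ≈⟨ ∙-congʳ (inverseˡ x) ⟨
      x ⁻¹ ∙ x ∙ g    ≈⟨ assoc (x ⁻¹) x g ⟩
      x ⁻¹ ∙ (x ∙ g)  ≈⟨ ∙-congˡ y≈xg ⟨
      x ⁻¹ ∙ y        ∎) g∈

    coset-reflexive : ∀ {x y} → x ≈ y → y ∈ [ x ] α
    coset-reflexive {x} {y} x≈y = ε , unit , ≈-trans (≈-sym x≈y) (≈-sym (identityʳ x))

    quotient-sym : ∀ {x y} → x ⁻¹ ∙ y ∈ Subgroup α → y ⁻¹ ∙ x ∈ Subgroup α
    quotient-sym {x} {y} q = resp (⁻¹-anti-homo-\\ x y) (inv q)

    coset-sym : ∀ {x y} → y ∈ [ x ] α → x ∈ [ y ] α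
    coset-sym = quotient⇒coset ∘ quotient-sym ∘ coset⇒quotient

    coset-trans : ∀ {x y z} → y ∈ [ x ] α → z ∈ [ y ] α → z ∈ [ x ] α
    coset-trans {x} (g , g∈ , y≈xg) (h , h∈ , z≈yh) =
      g ∙ h , mul g∈ h∈ , ≈-trans z≈yh (≈-trans (∙-congʳ y≈xg) (assoc x g h))

    coset-cong : ∀ {x y} → x ≈ y → [ x ] α ⊆ [ y ] α
    coset-cong x≈y = coset-trans (coset-reflexive (≈-sym x≈y))

  coset-mono : ∀ {α β : Pred Carrier p} {x} → α ⊆ β → [ x ] α ⊆ [ x ] β
  coset-mono α⊆β (g , g∈ , e) = g , ⟨⟩-mono α⊆β g∈ , e

  cosetˡ : ∀ {α β : Pred Carrier p} {x} → [ x ] (α ∩ β) ⊆ [ x ] α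
  cosetˡ = coset-mono proj₁

  cosetʳ : ∀ {α β : Pred Carrier p} {x} → [ x ] (α ∩ β) ⊆ [ x ] β
  cosetʳ = coset-mono proj₂

  coset-∩-comm : ∀ {α β : Pred Carrier p} {x} → [ x ] (α ∩ β) ⊆ [ x ] (β ∩ α)
  coset-∩-comm = coset-mono swap

  -- Walks and their reversal

  -- Unlike CosetPath, this leaves the first step (and prev b zero = ∅) unconstrained.
  record IsWalk {m} (s : Fin (suc (suc m)) → Carrier) (b : Fin (suc m) → Pred Carrier p)
         : Set (c ⊔ ℓ ⊔ p) where
    field
      subset   : ∀ i → IsGeneratorSubset (b i)
      step     : ∀ i → s (inject₁ i) ⁻¹ ∙ s (suc i) ∈ Subgroup (b i)
      disjoint : ∀ i → Empty
        (  [ s (suc (inject₁ i)) ] (b (inject₁ i) ∩ b (suc i))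
         ∩ [ s (suc (suc i)) ]     (b (suc i) ∩ next b (suc i)))

  isWalk : ∀ {l v u} (P : CosetPath l v u) → IsWalk (CosetPath.vertex P) (CosetPath.label P)
  isWalk P = record
    { subset   = CosetPath.subset P
    ; step     = CosetPath.step P
    ; disjoint = λ i → CosetPath.disjoint P (suc i)
    }

  tail : ∀ {m} {s : Fin (suc (suc (suc m))) → Carrier} {b : Fin (suc (suc m)) → Pred Carrier p} →
         IsWalk s b → IsWalk (s ∘ suc) (b ∘ suc)
  tail W = record { subset = subset ∘ suc ; step = step ∘ suc ; disjoint = disjoint ∘ suc }
    where open IsWalk W

  -- The first step of `r` is traversed backwards in front of `s`. The first step of `s`,
  -- unconstrained so far, thereby gets `β zero` as its previous label, and the corner hypothesis is
  -- exactly its new condition.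
  push-reversed : ∀ {k m}
    {r : Fin (suc (suc k)) → Carrier} {β : Fin (suc k) → Pred Carrier p}
    {s : Fin (suc (suc m)) → Carrier} {b : Fin (suc m) → Pred Carrier p} →
    IsWalk r β → IsWalk s b → r zero ≈ s zero →
    Empty ([ s zero ] (β zero ∩ b zero) ∩ [ s (suc zero) ] (b zero ∩ next b zero)) →
    IsWalk (r (suc zero) ∷ s) (β zero ∷ b)
  push-reversed {r = r} {β} {s} {b} R S r₀≈s₀ corner = record
    { subset = λ { zero → R.subset zero ; (suc i) → S.subset i }
    ; step   = λ
      { zero    → coset⇒quotient (coset-sym
                    (coset-cong r₀≈s₀ (quotient⇒coset (R.step zero))))
      ; (suc i) → S.step i }
    ; disjoint = λ { zero → corner ; (suc i) → S.disjoint i }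
    }
    where
    module R = IsWalk R
    module S = IsWalk S

  reverse : ∀ {l v u} → CosetPath l v u → CosetPath l u v
  reverse {l} P = record
    { vertex   = vertex ∘ opposite
    ; label    = label ∘ opposite
    ; start    = end
    ; end      = subst (λ j → vertex j ≈ _) (sym (opposite-fromℕ (suc l))) start
    ; subset   = subset ∘ opposite
    ; step     = step′
    ; disjoint = disjoint′
    }
    where
    open CosetPath P
    step′ : ∀ i → vertex (opposite (inject₁ i)) ⁻¹ ∙ vertex (inject₁ (opposite i))
                  ∈ Subgroup (label (opposite i))
    step′ i rewrite opposite-inject₁ i = quotient-sym (step (opposite i))
    disjoint′ : ∀ i → Empty
      (  [ vertex (opposite (inject₁ i)) ] (prev (label ∘ opposite) i ∩ label (opposite i))
       ∩ [ vertex (inject₁ (opposite i)) ] (label (opposite i) ∩ next (label ∘ opposite) i))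
    disjoint′ i x (x∈₁ , x∈₂)
      rewrite opposite-inject₁ i | prev-opposite label i | next-opposite label i
      -- Reversal exchanges the ends of a step together with the neighbouring labels, so the two
      -- memberships trade places.
      = disjoint (opposite i) x (coset-∩-comm x∈₂ , coset-∩-comm x∈₁)

  -- Closing a path to a coset cycle

  module _ {m} {s : Fin (suc m) → Carrier} {b : Fin (suc (suc m)) → Pred Carrier p} {x}
           (subset   : ∀ i → IsGeneratorSubset (b i))
           (step     : ∀ i → s (inject₁ i) ⁻¹ ∙ s (suc i) ∈ Subgroup (b (suc (inject₁ i))))
           (disjoint : ∀ i → Empty
             (  [ s (inject₁ i) ] (b (inject₁ (inject₁ i)) ∩ b (suc (inject₁ i)))
              ∩ [ s (suc i) ]     (b (suc (inject₁ i)) ∩ b (suc (suc i)))))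
           (x∈first  : x ∈ [ s zero ] (b zero))
           (x∈last   : x ∈ [ s (fromℕ m) ] (b (fromℕ (suc m))))
           (disjoint-first : Empty
             (  [ x ]      (b (fromℕ (suc m)) ∩ b zero)
              ∩ [ s zero ] (b zero ∩ b (suc zero))))
           (disjoint-last : Empty
             (  [ s (fromℕ m) ] (b (inject₁ (fromℕ m)) ∩ b (fromℕ (suc m)))
              ∩ [ x ]           (b (fromℕ (suc m)) ∩ b zero)))
           where

    -- With `x` put before `s`, step `i` carries the label `b i`. Only the first and the last step
    -- touch `x`; their conditions wrap around and are supplied by `disjoint-first` and
    -- `disjoint-last`.
    closeCycle : CosetCycle (suc m)
    closeCycle = record
      { vertex = vertex ; label = b ; subset = subset ; step = step′ ; disjoint = disjoint′ }
      where
      vertex : Fin (suc (suc m)) → Carrier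
      vertex = x ∷ s
      step′ : ∀ i → vertex i ⁻¹ ∙ vertex (sucᶜ i) ∈ Subgroup (b i)
      step′ i with view i
      ... | ‵fromℕ           = coset⇒quotient x∈last
      ... | ‵inject₁ zero    = coset⇒quotient (coset-sym x∈first)
      ... | ‵inject₁ (suc j) = step j
      disjoint′ : ∀ i → Empty
        (  [ vertex i ]        (b (predᶜ i) ∩ b i)
         ∩ [ vertex (sucᶜ i) ] (b i ∩ b (sucᶜ i)))
      disjoint′ i with view i
      ... | ‵fromℕ           = disjoint-last
      ... | ‵inject₁ zero    = disjoint-first
      ... | ‵inject₁ (suc j) = disjoint j

  -- Closed paths in an acyclic group

  module _ (em : ExcludedMiddle (c ⊔ ℓ ⊔ p)) {N : ℕ} (acyclic : Acyclic N) where

    -- The closed path is x, b₀, s₀, b₁, …, s_m, b_{m+1}, x.  Disjointness at the last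
    -- step is not assumed, so that absorbing the first step preserves the hypotheses.
    no-closed-path : ∀ m → suc (suc m) ≤ N →
      (s : Fin (suc m) → Carrier) (b : Fin (suc (suc m)) → Pred Carrier p) →
      (∀ i → IsGeneratorSubset (b i)) →
      (∀ i → s (inject₁ i) ⁻¹ ∙ s (suc i) ∈ Subgroup (b (suc (inject₁ i)))) →
      (∀ i → Empty
        (  [ s (inject₁ i) ] (b (inject₁ (inject₁ i)) ∩ b (suc (inject₁ i)))
         ∩ [ s (suc i) ]     (b (suc (inject₁ i)) ∩ b (suc (suc i))))) →
      ∀ x → x ∈ [ s zero ] (b zero) → x ∈ [ s (fromℕ m) ] (b (fromℕ (suc m))) →
      x ∉ [ s zero ] (b zero ∩ b (suc zero)) → ⊥
    no-closed-path zero m≤N s b sub st dis x x∈first x∈last x∉ =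
      -- Argument `1` stands for length 2. Both conditions now compare cosets of one and the same
      -- subgroup, so a common point would put `x` into the coset excluded by `x∉`.
      acyclic 1 m≤N (closeCycle {s = s} {b} sub st dis x∈first x∈last
        (λ y (y∈x , y∈s) → x∉ (coset-trans y∈s (coset-sym (coset-∩-comm y∈x))))
        (λ y (y∈s , y∈x) → x∉ (coset-trans y∈s (coset-sym (coset-∩-comm y∈x)))))
    no-closed-path (suc m) m≤N s b sub st dis x x∈first x∈last x∉
      with em {Satisfiable ( [ x ]      (b (fromℕ (suc (suc m))) ∩ b zero)
                           ∩ [ s zero ] (b zero ∩ b (suc zero)))}
         | em {Satisfiable ( [ s (fromℕ (suc m)) ]
                               (b (inject₁ (fromℕ (suc m))) ∩ b (fromℕ (suc (suc m))))
                           ∩ [ x ] (b (fromℕ (suc (suc m))) ∩ b zero))}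
    -- The closing point moves to `y`, and `s zero` and `b zero` drop out. Disjointness at the old
    -- step `b (suc zero)` keeps `y` out of the new excluded coset.
    ... | yes (y , y∈x , y∈s) | _ =
      no-closed-path m (≤-trans (n≤1+n _) m≤N) (s ∘ suc) (b ∘ suc)
        (sub ∘ suc) (st ∘ suc) (dis ∘ suc) y
        (coset-trans (quotient⇒coset (quotient-sym (st zero))) (cosetʳ y∈s))
        (coset-trans x∈last (cosetˡ y∈x))
        (λ y∈s₁ → dis zero y (y∈s , y∈s₁))
    -- Here the last vertex and label drop out. That `y` avoids the excluded coset at `s zero` rests
    -- on `¬first`, hence the order of the two tests.
    ... | no ¬first | yes (y , y∈s , y∈x) =
      no-closed-path m (≤-trans (n≤1+n _) m≤N) (s ∘ inject₁) (b ∘ inject₁)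
        (sub ∘ inject₁) (st ∘ inject₁) (dis ∘ inject₁) y
        (coset-trans x∈first (cosetʳ y∈x))
        (coset-trans (quotient⇒coset (st (fromℕ m))) (cosetˡ y∈s))
        (λ y∈s₀ → ¬first (y , y∈x , y∈s₀))
    ... | no ¬first | no ¬last =
      acyclic (suc (suc m)) m≤N (closeCycle {s = s} {b} sub st dis x∈first x∈last
        (λ y h → ¬first (y , h)) (λ y h → ¬last (y , h)))

    -- Induction on the length of `r`: its steps move one by one, reversed, to the front of `s`. The
    -- common start travels along `r` and the total length stays fixed. The two corners are the
    -- conditions on the two steps leaving that start.
    no-digon : ∀ k {m} → suc k + suc m ≤ N →
      {r : Fin (suc (suc k)) → Carrier} {β : Fin (suc k) → Pred Carrier p} → IsWalk r β →
      {s : Fin (suc (suc m)) → Carrier} {b : Fin (suc m) → Pred Carrier p} → IsWalk s b →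
      r zero ≈ s zero → r (fromℕ (suc k)) ≈ s (fromℕ (suc m)) →
      Empty ([ s zero ] (β zero ∩ b zero) ∩ [ s (suc zero) ] (b zero ∩ next b zero)) →
      Empty ([ s zero ] (β zero ∩ b zero) ∩ [ r (suc zero) ] (β zero ∩ next β zero)) →
      ⊥
    no-digon zero {m} k+m≤N {r} {β} R {s} {b} S r₀≈s₀ rₖ≈sₘ corner-s corner-r =
      no-closed-path m k+m≤N (s ∘ inject₁) (β zero ∷ b)
        W.subset (W.step ∘ suc ∘ inject₁)
        -- The last step of the walk, whose next label is `∅`, is left out, so `next` is an actual
        -- label here.
        (λ i x (x∈₁ , x∈₂) → W.disjoint (inject₁ i) x
          (x∈₁ , subst (λ γ → x ∈ [ s (suc (inject₁ i)) ] (b (inject₁ i) ∩ γ))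
                       (sym (next-inject₁ (β zero ∷ b) (suc i))) x∈₂))
        (r (suc zero))
        (coset-cong r₀≈s₀ (quotient⇒coset (R.step zero)))
        (coset-trans (quotient⇒coset (S.step (fromℕ m))) (coset-reflexive (≈-sym rₖ≈sₘ)))
        (λ r₁∈ → corner-r (r (suc zero)) (r₁∈ , coset-reflexive ≈-refl))
      where
      module R = IsWalk R
      module S = IsWalk S
      module W = IsWalk (push-reversed R S r₀≈s₀ corner-s)
    no-digon (suc k) {m} k+m≤N R S r₀≈s₀ rₖ≈sₘ corner-s corner-r =
      no-digon k (subst (_≤ N) (sym (+-suc (suc k) (suc m))) k+m≤N)
        (tail R) (push-reversed R S r₀≈s₀ corner-s) ≈-refl rₖ≈sₘ
        -- Seen from the new start, the old corner along `r` is read backwards as the corner along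
        -- `s`; the disjointness within `r` gives the new corner along `r`.
        (λ x (x∈r₁ , x∈s₀) → corner-r x (x∈s₀ , coset-∩-comm x∈r₁))
        (λ x (x∈₁ , x∈₂) → IsWalk.disjoint R zero x (coset-∩-comm x∈₁ , x∈₂))

    zipper-start : ∀ {v u l k} → suc k + suc l ≤ N →
      (P : CosetPath l v u) (Q : CosetPath k v u) →
      let module P = CosetPath P
          module Q = CosetPath Q
          α₁ = P.label zero
          β₁ = Q.label zero
      in
        Satisfiable ([ v ] (β₁ ∩ α₁) ∩ [ P.vertex (suc zero) ] (α₁ ∩ next P.label zero))
      ⊎ Satisfiable ([ v ] (α₁ ∩ β₁) ∩ [ Q.vertex (suc zero) ] (β₁ ∩ next Q.label zero))
    zipper-start k+l≤N P Q = em⇒dne em λ ¬zip →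
      no-digon _ k+l≤N (isWalk Q) (isWalk P)
        (≈-trans Q.start (≈-sym P.start)) (≈-trans Q.end (≈-sym P.end))
        (λ x (x∈v , x∈t) → ¬zip (inj₁ (x , coset-cong P.start x∈v , x∈t)))
        (λ x (x∈v , x∈r) → ¬zip (inj₂ (x , coset-∩-comm (coset-cong P.start x∈v) , x∈r)))
      where
      module P = CosetPath P
      module Q = CosetPath Q

lemma4p8 :
  ∀ {c ℓ p} → ExcludedMiddle (c ⊔ ℓ ⊔ p) →
  (n : ℕ) → 1 ≤ n →
  (G : CayleyGroup c ℓ p) →
  let open CayleyGroup G in
  Acyclic (2 * n) →
  (v u : Carrier) (l k : ℕ) → suc l ≤ n → suc k ≤ n →
  (P : CosetPath l v u) (Q : CosetPath k v u) →
  let t  = CosetPath.vertex P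
      α  = CosetPath.label P
      r  = CosetPath.vertex Q
      β  = CosetPath.label Q
      α₁ = α zero
      β₁ = β zero
      t₂ = t (suc zero)
      r₂ = r (suc zero)
      αₗ = α (fromℕ l)
      βₖ = β (fromℕ k)
      tₗ = t (inject₁ (fromℕ l))
      rₖ = r (inject₁ (fromℕ k))
  in
  ( Satisfiable (([ v ] (β₁ ∩ α₁)) ∩ ([ t₂ ] (α₁ ∩ next α zero)))
  ⊎ Satisfiable (([ v ] (α₁ ∩ β₁)) ∩ ([ r₂ ] (β₁ ∩ next β zero))))
  ×
  ( Satisfiable (([ u ] (βₖ ∩ αₗ)) ∩ ([ tₗ ] (αₗ ∩ prev α (fromℕ l))))
  ⊎ Satisfiable (([ u ] (αₗ ∩ βₖ)) ∩ ([ rₖ ] (βₖ ∩ prev β (fromℕ k)))))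
lemma4p8 em n _ G acyclic v u l k l≤n k≤n P Q =
  zipper-start G em acyclic k+l≤2n P Q , at-end
  where
  open CayleyGroup G using ([_]_; module CosetPath)
  open CosetPath P using () renaming (vertex to t; label to α)
  open CosetPath Q using () renaming (vertex to r; label to β)
  k+l≤2n : suc k + suc l ≤ 2 * n
  k+l≤2n = +-mono-≤ k≤n (subst (suc l ≤_) (sym (+-identityʳ n)) l≤n)
  at-end :
      Satisfiable ([ u ] (β (fromℕ k) ∩ α (fromℕ l))
                 ∩ [ t (inject₁ (fromℕ l)) ] (α (fromℕ l) ∩ prev α (fromℕ l)))
    ⊎ Satisfiable ([ u ] (α (fromℕ l) ∩ β (fromℕ k))
                 ∩ [ r (inject₁ (fromℕ k)) ] (β (fromℕ k) ∩ prev β (fromℕ k)))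
  at-end with zipper-start G em acyclic k+l≤2n (reverse G P) (reverse G Q)
  -- Labels and vertices of the reversed paths compute to those at the end; only `next` must be
  -- turned into `prev`.
  ... | zip rewrite next-opposite α zero | next-opposite β zero = zip
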